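{- Let $k\geq 3$ and let $2\leq n_1\leq n_2\leq \cdots\leq n_k$ be integers. The $n_1\times\cdots\times n_k$ chessboard has \emph{no} closed knight tour if and only if at least one of the following holds: (a) $n_i$ is odd for every $i\in\{1,\dots,k\}$; (b) $n_{k-1}=2$; (c) $n_k=3$.
   Context: The $n_1\times\cdots\times n_k$ chessboard is the set $\mathcal{B}=\{1,\dots,n_1\}\times\cdots\times\{1,\dots,n_k\}\subset\mathbb{Z}^k$. A knight move is a vector $c\in\mathbb{Z}^k$ having exactly one coordinate in $\{\pm1\}$, exactly one coordinate in $\{\pm 2\}$, and all other $k-2$ coordinates equal to $0$. The knight graph on $\mathcal{B}$ has an edge between $a,b\in\mathcal{B}$ iff $a-b$ is a knight move. A closed knight tour is a Hamiltonian cycle in this graph. -}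

module Defs where

open import Data.Fin.Base using (Fin)
open import Data.Integer.Base using (ℤ; +_; -_; 0ℤ; 1ℤ; _-_; _≤_)
open import Data.List.Base using (List; _∷_; _∷ʳ_; length)
open import Data.List.Membership.Propositional using (_∈_)
open import Data.List.Relation.Unary.Linked using (Linked)
open import Data.List.Relation.Unary.Unique.Propositional using (Unique)
open import Data.Nat.Base as ℕ using (ℕ)
open import Data.Product.Base using (_×_; ∃₂)
open import Data.Sum.Base using (_⊎_)
open import Data.Vec.Base using (Vec; lookup; zipWith)
open import Function.Bundles using (_⇔_)
open import Relation.Binary.PropositionalEquality using (_≡_; _≢_)

-- Vertices form a predicate on an ambient type rather than a Σ-type, so that
-- equality of vertices does not depend on proofs of membership.
record Graph (A : Set) : Set₁ where
  field
    Vertex : A → Set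
    Edge   : A → A → Set

-- The cycle v₀ v₁ … vₘ v₀ is given by start = v₀ and rest = v₁ … vₘ.
record HamiltonianCycle {A : Set} (G : Graph A) : Set where
  open Graph G
  field
    start    : A
    rest     : List A
    atLeast3 : 3 ℕ.≤ length (start ∷ rest)
    closed   : Linked Edge (start ∷ rest ∷ʳ start)
    distinct : Unique (start ∷ rest)
    spanning : ∀ v → Vertex v ⇔ v ∈ start ∷ rest

OnBoard : ∀ {k} → Vec ℕ k → Vec ℤ k → Set
OnBoard n a = ∀ i → 1ℤ ≤ lookup a i × lookup a i ≤ + lookup n i

-- That i ≢ j, and that i and j are the only coordinates with values in {±1}
-- and {±2} respectively, follows from the conditions listed.
KnightMove : ∀ {k} → Vec ℤ k → Set
KnightMove {k} c = ∃₂ λ (i j : Fin k) →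
  (lookup c i ≡ + 1 ⊎ lookup c i ≡ - (+ 1)) ×
  (lookup c j ≡ + 2 ⊎ lookup c j ≡ - (+ 2)) ×
  (∀ l → l ≢ i → l ≢ j → lookup c l ≡ 0ℤ)

knightGraph : ∀ {k} → Vec ℕ k → Graph (Vec ℤ k)
knightGraph n = record
  { Vertex = OnBoard n
  ; Edge   = λ a b → OnBoard n a × OnBoard n b × KnightMove (zipWith _-_ a b)
  }

ClosedKnightTour : ∀ {k} → Vec ℕ k → Set
ClosedKnightTour n = HamiltonianCycle (knightGraph n)

{-# OPTIONS --safe #-}
module Submission where

-- Two tours of disjoint boards, one traversing an edge ab and the other an
-- edge cd with ac and bd knight moves, merge into one tour of the union when
-- ab and cd are replaced by ac and bd. A tour through two disjoint pairs of
-- edges at distance 2 can be stacked: copies of it in consecutive layers of a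
-- further dimension are merged along one pair, and the other pair yields two
-- such pairs for the new tour. Hence it suffices to treat three dimensions.
-- There, twelve small tours traverse suitable edges next to the faces of the
-- board, so that boards agreeing in two sides can be glued along the third;
-- together they generate every three-dimensional board required.
-- Conversely, a tour is impossible if the number of squares is odd, since
-- moves alternate colours; if only the last side exceeds 2, since every move
-- preserves the parity of the last coordinate; and if no side exceeds 3, since
-- the centre is isolated.

open import Defs
open import Data.Fin.Base as Fin using (zero; fromℕ; inject₁)
open import Data.Nat.Base using (ℕ; _+_; _≤_)
open import Data.Nat.Divisibility using (_∤_)
open import Data.Sum.Base using (_⊎_)
open import Data.Vec.Base using (Vec; lookup)
open import Function.Bundles using (_⇔_)
open import Relation.Binary.Core using (_Preserves_⟶_)
open import Relation.Binary.PropositionalEquality using (_≡_)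
open import Relation.Nullary using (¬_)

import Algebra.Properties.AbelianGroup as AbelianGroupProperties
import Algebra.Properties.CommutativeSemigroup as CommutativeSemigroupProperties
import Algebra.Solver.CommutativeMonoid as CommutativeMonoidSolver
open import Data.Bool.Base using (T)
open import Data.Empty using (⊥)
open import Data.Fin.Base using (Fin; suc; toℕ)
open import Data.Fin.Permutation using (Permutation′; _⟨$⟩ʳ_; _⟨$⟩ˡ_; inverseˡ; inverseʳ; transpose; flip)
import Data.Fin.Properties as Fin
open import Data.Integer.Base as ℤ using (ℤ; +_; -[1+_]; 0ℤ; 1ℤ; +≤+; ∣_∣)
import Data.Integer.Properties as ℤ
open import Data.List.Base using (List; []; _∷_; _++_; _∷ʳ_; [_]; map; length; upTo; cartesianProductWith)
import Data.List.Membership.DecPropositional as DecMembership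
open import Data.List.Membership.Propositional using (_∈_)
open import Data.List.Membership.Propositional.Properties
open import Data.List.Membership.Propositional.Properties.WithK using (unique∧set⇒bag)
import Data.List.Properties as List
open import Data.List.Relation.Binary.BagAndSetEquality using (∼bag⇒↭)
open import Data.List.Relation.Binary.Permutation.Propositional
open import Data.List.Relation.Binary.Permutation.Propositional.Properties
import Data.List.Relation.Binary.Permutation.Setoid.Properties as SetoidPermutation
open import Data.List.Relation.Unary.All as All using (All; []; _∷_; all?)
open import Data.List.Relation.Unary.AllPairs using ([]; _∷_)
open import Data.List.Relation.Unary.Any as Any using (here; there; any?; _─_)
open import Data.List.Relation.Unary.Any.Properties using (lookup-result)
open import Data.List.Relation.Unary.Linked as Linked using (Linked; []; [-]; _∷_)
import Data.List.Relation.Unary.Unique.DecPropositional as DecUnique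
open import Data.List.Relation.Unary.Unique.Propositional using (Unique)
import Data.List.Relation.Unary.Unique.Propositional.Properties as Unique
open import Data.Maybe using (Maybe; just; nothing; is-just; to-witness-T)
import Data.Maybe as Maybe
open import Data.Nat.Base as ℕ using (zero; suc; _*_; _∸_; _/_; _%_; _<_; z≤n; s≤s; parity)
open import Data.Nat.Divisibility using (_∣_; divides; _∣?_)
import Data.Nat.Properties as ℕ
open import Data.Parity.Base as ℙ using (Parity; 0ℙ; 1ℙ; _⁻¹)
import Data.Parity.Properties as ℙ
open import Data.Product.Base as Product using (_×_; _,_; ∃; proj₁; proj₂)
open import Data.Product.Properties using () renaming (≡-dec to ×-≡-dec)
open import Data.Sum.Base as Sum using (inj₁; inj₂)
open import Data.Vec.Base as Vec using ([]; _∷_; tabulate; zipWith)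
import Data.Vec.Properties as Vec
open import Function.Base using (_∘_; id)
open import Function.Bundles using (mk⇔; Equivalence)
open import Relation.Binary.Definitions using (Symmetric; Decidable; DecidableEquality)
open import Relation.Binary.PropositionalEquality as ≡ using (_≢_; refl; cong; cong₂; subst; module ≡-Reasoning)
open import Relation.Nullary using (Dec; yes; no; contradiction)
open import Relation.Nullary.Decidable using (True; toWitness; map′; _×-dec_; _⊎-dec_; _→-dec_; ¬?)

-- Paths with marked edges

private
  module ↭-Solver {A : Set} =
    CommutativeMonoidSolver (++-commutativeMonoid {A = A})
open ↭-Solver using (solve; _⊜_; _⊕_)

private variable
  k : ℕ
  n : Vec ℕ k
  A B : Set
  R : A → A → Set

-- A mark has an orientation of its own, independent of the direction in which a path runs through
-- it: gluing matches first ends with first ends, so the orientation has to survive reversal.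
Joins : A × A → A → A → Set
Joins e v w = e ≡ (v , w) ⊎ e ≡ (w , v)

-- A path from u to v with vertices vs, both vs and es being taken up to order.
-- Only the marked edges, recorded in es, can be removed later; since es is a
-- multiset, removing one of them keeps the others.
data Path {A : Set} (R : A → A → Set) : A → A → List A → List (A × A) → Set where
  point  : ∀ u → Path R u u [ u ] []
  join   : ∀ {u v w x vs vs′ es es′} →
           Path R u v vs es → R v w → Path R w x vs′ es′ →
           Path R u x (vs ++ vs′) (es ++ es′)
  mark   : ∀ {u v w x vs vs′ es es′} e →
           Path R u v vs es → R v w → Joins e v w → Path R w x vs′ es′ →
           Path R u x (vs ++ vs′) (e ∷ es ++ es′)
  reorder : ∀ {u v vs vs′ es es′} →
           vs ↭ vs′ → es ↭ es′ → Path R u v vs es → Path R u v vs′ es′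

reversePath : Symmetric R → ∀ {u v vs es} → Path R u v vs es → Path R v u vs es
reversePath s (point u) = point u
reversePath s (join {vs = vs} {es = es} p r q) =
  reorder (++-comm _ vs) (++-comm _ es)
    (join (reversePath s q) (s r) (reversePath s p))
reversePath s (mark {vs = vs} {es = es} e p r j q) =
  reorder (++-comm _ vs) (prep e (++-comm _ es))
    (mark e (reversePath s q) (s r) (Sum.swap j) (reversePath s p))
reversePath s (reorder σ τ p) = reorder σ τ (reversePath s p)

mapEdge : (A → B) → A × A → B × B
mapEdge f = Product.map f f

mapPath : ∀ {R : A → A → Set} {S : B → B → Set} (f : A → B) →
          (∀ {a b} → R a b → S (f a) (f b)) →
          ∀ {u v vs es} → Path R u v vs es →
          Path S (f u) (f v) (map f vs) (map (mapEdge f) es)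
mapPath f h (point u) = point (f u)
mapPath f h (join {vs = vs} {es = es} p r q) =
  reorder (↭-reflexive (≡.sym (List.map-++ f vs _))) (↭-reflexive (≡.sym (List.map-++ (mapEdge f) es _)))
    (join (mapPath f h p) (h r) (mapPath f h q))
mapPath f h (mark {vs = vs} {es = es} e p r j q) =
  reorder (↭-reflexive (≡.sym (List.map-++ f vs _)))
    (↭-reflexive (≡.sym (cong (mapEdge f e ∷_) (List.map-++ (mapEdge f) es _))))
    (mark (mapEdge f e) (mapPath f h p) (h r)
      (Sum.map (cong (mapEdge f)) (cong (mapEdge f)) j) (mapPath f h q))
mapPath f h (reorder σ τ p) = reorder (map⁺ f σ) (map⁺ (mapEdge f) τ) (mapPath f h p)

record Cut {A : Set} (R : A → A → Set) (u v : A) (vs : List A) (es : List (A × A)) (e : A × A) : Set where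
  field
    {a b}     : A
    {vs₁ vs₂} : List A
    {es₁ es₂} : List (A × A)
    left      : Path R u a vs₁ es₁
    right     : Path R b v vs₂ es₂
    joins     : Joins e a b
    vertices  : vs₁ ++ vs₂ ↭ vs
    edges     : e ∷ es₁ ++ es₂ ↭ es

-- The mark is the edge between two subpaths or lies in one of them; then that subpath is cut and
-- the other stays attached to the adjacent piece. The solver only rearranges multisets.
cut : ∀ {u v vs es e} → Path R u v vs es → e ∈ es → Cut R u v vs es e
cut (join {vs = vs} {vs′} {es} {es′} p r q) e∈ with ∈-++⁻ es e∈
... | inj₁ e∈es = let open Cut (cut p e∈es) in record
  { left = left ; right = join right r q ; joins = joins
  ; vertices = trans (↭-sym (++-assoc vs₁ vs₂ vs′)) (++⁺ʳ vs′ vertices)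
  ; edges = trans (↭-sym (++-assoc (_ ∷ es₁) es₂ es′)) (++⁺ʳ es′ edges) }
... | inj₂ e∈es′ = let open Cut (cut q e∈es′) in record
  { left = join p r left ; right = right ; joins = joins
  ; vertices = trans (++-assoc vs vs₁ vs₂) (++⁺ˡ vs vertices)
  ; edges = trans
      (solve 4 (λ e es es₁ es₂ → e ⊕ (es ⊕ es₁) ⊕ es₂ ⊜ es ⊕ e ⊕ es₁ ⊕ es₂) refl [ _ ] es es₁ es₂)
      (++⁺ˡ es edges) }
cut (mark e p r j q) (here refl) = record
  { left = p ; right = q ; joins = j ; vertices = refl ; edges = refl }
cut (mark {vs = vs} {vs′} {es} {es′} m p r j q) (there e∈) with ∈-++⁻ es e∈
... | inj₁ e∈es = let open Cut (cut p e∈es) in record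
  { left = left ; right = mark m right r j q ; joins = joins
  ; vertices = trans (↭-sym (++-assoc vs₁ vs₂ vs′)) (++⁺ʳ vs′ vertices)
  ; edges = trans
      (solve 5 (λ e m es₁ es₂ es′ → e ⊕ es₁ ⊕ m ⊕ es₂ ⊕ es′ ⊜ m ⊕ (e ⊕ es₁ ⊕ es₂) ⊕ es′) refl
        [ _ ] [ m ] es₁ es₂ es′)
      (prep m (++⁺ʳ es′ edges)) }
... | inj₂ e∈es′ = let open Cut (cut q e∈es′) in record
  { left = mark m p r j left ; right = right ; joins = joins
  ; vertices = trans (++-assoc vs vs₁ vs₂) (++⁺ˡ vs vertices)
  ; edges = trans
      (solve 5 (λ e m es es₁ es₂ → e ⊕ (m ⊕ es ⊕ es₁) ⊕ es₂ ⊜ m ⊕ es ⊕ e ⊕ es₁ ⊕ es₂) refl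
        [ _ ] [ m ] es es₁ es₂)
      (prep m (++⁺ˡ es edges)) }
cut (reorder σ τ p) e∈ = let open Cut (cut p (∈-resp-↭ (↭-sym τ) e∈)) in record
  { left = left ; right = right ; joins = joins
  ; vertices = trans vertices σ ; edges = trans edges τ }

-- The edge from `v` to `u` closes the path to a cycle. Opening this cycle at `e` instead gives a
-- path between the ends of `e` that keeps all other marks.
reroute : Symmetric R → ∀ {u v vs e es} → Path R u v vs (e ∷ es) → R v u →
          Path R (proj₁ e) (proj₂ e) vs es
reroute s p r with cut p (here refl)
... | record { vs₁ = vs₁ ; es₁ = es₁ ; left = l ; right = q ; joins = j ; vertices = σ ; edges = τ } = orient j
  where
  -- This path takes the right piece, the former closing edge and the left piece, so it is reversed
  -- below if `e` was traversed in its own orientation.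
  p′ = reorder (trans (++-comm _ vs₁) σ) (trans (++-comm _ es₁) (drop-∷ τ)) (join q r l)
  orient : Joins _ _ _ → Path _ _ _ _ _
  orient (inj₁ refl) = reversePath s p′
  orient (inj₂ refl) = p′

-- Tours with marked edges and their gluing

Spans : (A → Set) → List A → Set
Spans V vs = Unique vs × (∀ a → V a ⇔ a ∈ vs)

-- `es′` absorbs marks that are no longer wanted, so that `es` lists just those reserved for later
-- gluing. The closing edge carries no mark.
record Tour {A : Set} (R : A → A → Set) (V : A → Set) (es : List (A × A)) : Set where
  field
    {u v}   : A
    {vs}    : List A
    {es′}   : List (A × A)
    path    : Path R u v vs (es ++ es′)
    closing : R v u
    spans   : Spans V vs

infixr 5 _∷_

-- Sub-multisets, given by successive positions so that concrete instances are
-- sequences of indices.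
data _⊑_ {A : Set} : List A → List A → Set where
  []  : ∀ {ys} → [] ⊑ ys
  _∷_ : ∀ {x xs ys} (x∈ys : x ∈ ys) → xs ⊑ (ys ─ x∈ys) → (x ∷ xs) ⊑ ys

pattern 0th = here refl
pattern 1st = there 0th
pattern 2nd = there 1st
pattern 3rd = there 2nd
pattern 4th = there 3rd
pattern 5th = there 4th
pattern 6th = there 5th

↭-─ : ∀ {x : A} {xs} (x∈xs : x ∈ xs) → xs ↭ x ∷ (xs ─ x∈xs)
↭-─ (here refl) = refl
↭-─ (there x∈xs) = trans (prep _ (↭-─ x∈xs)) (swap _ _ refl)

⊑⇒↭ : ∀ {xs ys : List A} → xs ⊑ ys → ∃ λ zs → ys ↭ xs ++ zs
⊑⇒↭ []       = _ , refl
⊑⇒↭ (x∈ys ∷ xs⊑) with ⊑⇒↭ xs⊑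
... | zs , σ = zs , trans (↭-─ x∈ys) (prep _ σ)

select : ∀ {V : A → Set} {es fs} → fs ⊑ es → Tour R V es → Tour R V fs
select {fs = fs} fs⊑es t with ⊑⇒↭ fs⊑es
... | zs , σ = record
  { path = reorder refl (trans (++⁺ʳ _ σ) (++-assoc fs zs _)) path ; closing = closing ; spans = spans }
  where open Tour t

mapTour : ∀ {R : A → A → Set} {S : B → B → Set} {V W} (f : A → B) →
          (∀ {a b} → R a b → S (f a) (f b)) →
          (∀ {a b} → f a ≡ f b → a ≡ b) →
          (∀ b → W b ⇔ ∃ λ a → V a × b ≡ f a) →
          ∀ {es} → Tour R V es → Tour S W (map (mapEdge f) es)
mapTour f step inj onto {es} t = record
  { path = reorder refl (↭-reflexive (List.map-++ (mapEdge f) es _)) (mapPath f step path)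
  ; closing = step closing
  ; spans = Unique.map⁺ inj (proj₁ spans) , λ b → mk⇔
      (λ wb → let a , va , eq = Equivalence.to (onto b) wb in
         subst (_∈ _) (≡.sym eq) (∈-map⁺ f (Equivalence.to (proj₂ spans a) va)))
      (λ b∈ → let a , a∈ , eq = ∈-map⁻ f b∈ in
         Equivalence.from (onto b) (a , Equivalence.from (proj₂ spans a) a∈ , eq))
  }
  where open Tour t

-- The new cycle runs from `b` to `a` through the first tour, crosses to `c`, runs to `d` through
-- the second and closes from `d` to `b`.
glue : ∀ {V W U : A → Set} → Symmetric R →
       (∀ a → U a ⇔ (V a ⊎ W a)) → (∀ {a} → V a → W a → ⊥) →
       ∀ {a b c d es fs} → Tour R V ((a , b) ∷ es) → Tour R W ((c , d) ∷ fs) →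
       R a c → R b d → Tour R U (es ++ fs)
glue s union disjoint {es = es} {fs} t t′ ac bd = record
  { path = reorder refl (solve 4 (λ a b c d → (a ⊕ b) ⊕ (c ⊕ d) ⊜ (a ⊕ c) ⊕ (b ⊕ d)) refl es T.es′ fs T′.es′)
      (join (reversePath s (reroute s T.path T.closing)) ac (reroute s T′.path T′.closing))
  ; closing = s bd
  ; spans = Unique.++⁺ (proj₁ T.spans) (proj₁ T′.spans)
      (λ (a∈ , a∈′) → disjoint (Equivalence.from (proj₂ T.spans _) a∈)
                               (Equivalence.from (proj₂ T′.spans _) a∈′))
    , λ a → mk⇔
      (λ ua → Sum.[ ∈-++⁺ˡ ∘ Equivalence.to (proj₂ T.spans a)
                  , ∈-++⁺ʳ _ ∘ Equivalence.to (proj₂ T′.spans a) ]′ (Equivalence.to (union a) ua))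
      (λ a∈ → Equivalence.from (union a)
         (Sum.map (Equivalence.from (proj₂ T.spans a))
                  (Equivalence.from (proj₂ T′.spans a)) (∈-++⁻ _ a∈)))
  }
  where
  module T = Tour t
  module T′ = Tour t′

-- Knight moves and boards

gap : ℤ → ℤ → ℕ
gap x y = ∣ x ℤ.- y ∣

gap-refl : ∀ x → gap x x ≡ 0
gap-refl x = cong ∣_∣ (ℤ.+-inverseʳ x)

gap-translate : ∀ c x y → gap (c ℤ.+ x) (c ℤ.+ y) ≡ gap x y
gap-translate c x y = cong ∣_∣ (begin
  (c ℤ.+ x) ℤ.- (c ℤ.+ y) ≡⟨ cong (ℤ._- (c ℤ.+ y)) (ℤ.+-comm c x) ⟩
  (x ℤ.+ c) ℤ.- (c ℤ.+ y) ≡⟨ cong (λ z → (x ℤ.+ c) ℤ.+ z) (ℤ.neg-distrib-+ c y) ⟩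
  (x ℤ.+ c) ℤ.+ (ℤ.- c ℤ.- y) ≡⟨ ℤ.+-assoc x c _ ⟩
  x ℤ.+ (c ℤ.+ (ℤ.- c ℤ.- y)) ≡⟨ cong (λ z → x ℤ.+ z) (ℤ.+-assoc c (ℤ.- c) (ℤ.- y)) ⟨
  x ℤ.+ ((c ℤ.- c) ℤ.- y) ≡⟨ cong (λ z → x ℤ.+ (z ℤ.- y)) (ℤ.+-inverseʳ c) ⟩
  x ℤ.+ (0ℤ ℤ.- y) ≡⟨ cong (λ z → x ℤ.+ z) (ℤ.+-identityˡ (ℤ.- y)) ⟩
  x ℤ.- y ∎)
  where open ≡-Reasoning

-- This is `KnightMove` of the difference, up to signs. Absolute differences make it easy to carry
-- along reversal, translation and permutation of coordinates.
record Step (a b : Vec ℤ k) : Set where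
  constructor step
  field
    i j      : Fin k
    one      : gap (lookup a i) (lookup b i) ≡ 1
    two      : gap (lookup a j) (lookup b j) ≡ 2
    constant : ∀ l → l ≢ i → l ≢ j → gap (lookup a l) (lookup b l) ≡ 0

-- Not itself a knight move, but it becomes one together with a unit step in a new coordinate; this
-- is how adjacent layers are linked.
record DoubleStep (a b : Vec ℤ k) : Set where
  constructor doubleStep
  field
    j        : Fin k
    two      : gap (lookup a j) (lookup b j) ≡ 2
    constant : ∀ l → l ≢ j → gap (lookup a l) (lookup b l) ≡ 0

Step-sym : Symmetric (Step {k})
Step-sym {x = a} {y = b} (step i j p q r) =
  step i j (≡.trans (gap-sym i) p) (≡.trans (gap-sym j) q) λ l l≢i l≢j → ≡.trans (gap-sym l) (r l l≢i l≢j)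
  where
  gap-sym : ∀ l → gap (lookup b l) (lookup a l) ≡ gap (lookup a l) (lookup b l)
  gap-sym l = ℤ.∣i-j∣≡∣j-i∣ (lookup b l) (lookup a l)

Step-∷ : ∀ x {a b : Vec ℤ k} → Step a b → Step (x ∷ a) (x ∷ b)
Step-∷ x (step i j p q r) = step (suc i) (suc j) p q λ where
  zero    _   _   → gap-refl x
  (suc l) l≢i l≢j → r l (l≢i ∘ cong suc) (l≢j ∘ cong suc)

DoubleStep-∷ : ∀ x {a b : Vec ℤ k} → DoubleStep a b → DoubleStep (x ∷ a) (x ∷ b)
DoubleStep-∷ x (doubleStep j q r) = doubleStep (suc j) q λ where
  zero    _   → gap-refl x
  (suc l) l≢j → r l (l≢j ∘ cong suc)

DoubleStep⇒Step : ∀ {x y} {a b : Vec ℤ k} → gap x y ≡ 1 → DoubleStep a b → Step (x ∷ a) (y ∷ b)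
DoubleStep⇒Step p (doubleStep j q r) = step zero (suc j) p q λ where
  zero    l≢0 _   → contradiction refl l≢0
  (suc l) _   l≢j → r l (l≢j ∘ cong suc)

translate : ℕ → Vec ℤ (suc k) → Vec ℤ (suc k)
translate p (x ∷ a) = (+ p ℤ.+ x) ∷ a

Step-translate : ∀ p {a b : Vec ℤ (suc k)} → Step a b → Step (translate p a) (translate p b)
Step-translate p {x ∷ a} {y ∷ b} (step i j e₁ e₂ e₀) =
  step i j (≡.trans (same i) e₁) (≡.trans (same j) e₂) λ l l≢i l≢j → ≡.trans (same l) (e₀ l l≢i l≢j)
  where
  same : ∀ l → gap (lookup (translate p (x ∷ a)) l) (lookup (translate p (y ∷ b)) l)
             ≡ gap (lookup (x ∷ a) l) (lookup (y ∷ b) l)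
  same zero    = gap-translate (+ p) x y
  same (suc _) = refl

permute : Permutation′ k → {A : Set} → Vec A k → Vec A k
permute π a = tabulate (λ i → lookup a (π ⟨$⟩ʳ i))

module _ {A : Set} (π : Permutation′ k) where
  lookup-permute : ∀ (a : Vec A k) i → lookup (permute π a) i ≡ lookup a (π ⟨$⟩ʳ i)
  lookup-permute a i = Vec.lookup∘tabulate _ i

  permute-flip : ∀ (a : Vec A k) → permute π (permute (flip π) a) ≡ a
  permute-flip a = ≡.trans
    (Vec.tabulate-cong λ i → ≡.trans
      (Vec.lookup∘tabulate (λ j → lookup a (π ⟨$⟩ˡ j)) (π ⟨$⟩ʳ i))
      (cong (lookup a) (inverseˡ π)))
    (Vec.tabulate∘lookup a)

  permute-injective : ∀ {a b : Vec A k} → permute π a ≡ permute π b → a ≡ b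
  permute-injective {a} {b} eq = begin
    a                    ≡⟨ Vec.tabulate∘lookup a ⟨
    tabulate (lookup a)  ≡⟨ Vec.tabulate-cong (λ i → begin
      lookup a i                            ≡⟨ cong (lookup a) (inverseʳ π) ⟨
      lookup a (π ⟨$⟩ʳ (π ⟨$⟩ˡ i))          ≡⟨ lookup-permute a _ ⟨
      lookup (permute π a) (π ⟨$⟩ˡ i)       ≡⟨ cong (λ c → lookup c (π ⟨$⟩ˡ i)) eq ⟩
      lookup (permute π b) (π ⟨$⟩ˡ i)       ≡⟨ lookup-permute b _ ⟩
      lookup b (π ⟨$⟩ʳ (π ⟨$⟩ˡ i))          ≡⟨ cong (lookup b) (inverseʳ π) ⟩
      lookup b i                            ∎) ⟩
    tabulate (lookup b)  ≡⟨ Vec.tabulate∘lookup b ⟩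
    b                    ∎
    where open ≡-Reasoning

module _ (π : Permutation′ k) {a b : Vec ℤ k} where
  private
    gap-permute : ∀ i → gap (lookup (permute π a) i) (lookup (permute π b) i)
                      ≡ gap (lookup a (π ⟨$⟩ʳ i)) (lookup b (π ⟨$⟩ʳ i))
    gap-permute i = cong₂ gap (lookup-permute π a i) (lookup-permute π b i)

    gap-permuteˡ : ∀ i → gap (lookup (permute π a) (π ⟨$⟩ˡ i)) (lookup (permute π b) (π ⟨$⟩ˡ i))
                      ≡ gap (lookup a i) (lookup b i)
    gap-permuteˡ i = ≡.trans (gap-permute _) (cong (λ j → gap (lookup a j) (lookup b j)) (inverseʳ π))

    moved : ∀ {i l} → l ≢ π ⟨$⟩ˡ i → π ⟨$⟩ʳ l ≢ i
    moved l≢ refl = l≢ (≡.sym (inverseˡ π))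

  Step-permute : Step a b → Step (permute π a) (permute π b)
  Step-permute (step i j p q r) = step (π ⟨$⟩ˡ i) (π ⟨$⟩ˡ j)
    (≡.trans (gap-permuteˡ i) p) (≡.trans (gap-permuteˡ j) q)
    λ l l≢i l≢j → ≡.trans (gap-permute l) (r _ (moved l≢i) (moved l≢j))

  DoubleStep-permute : DoubleStep a b → DoubleStep (permute π a) (permute π b)
  DoubleStep-permute (doubleStep j q r) = doubleStep (π ⟨$⟩ˡ j)
    (≡.trans (gap-permuteˡ j) q) λ l l≢j → ≡.trans (gap-permute l) (r _ (moved l≢j))

-- Tours of boards

BoardTour : Vec ℕ k → List (Vec ℤ k × Vec ℤ k) → Set
BoardTour n = Tour Step (OnBoard n)

OnBoard-∷ : ∀ {p x} {a : Vec ℤ k} → 1ℤ ℤ.≤ x → x ℤ.≤ + p → OnBoard n a → OnBoard (p ∷ n) (x ∷ a)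
OnBoard-∷ lo hi on zero    = lo , hi
OnBoard-∷ lo hi on (suc i) = on i

thicken : ∀ {es} → BoardTour n es → BoardTour (1 ∷ n) (map (mapEdge (1ℤ ∷_)) es)
thicken {n = n} = mapTour (1ℤ ∷_) (Step-∷ 1ℤ) Vec.∷-injectiveʳ λ where
  (x ∷ a) → mk⇔
    (λ on → a , on ∘ suc , cong (_∷ a) (ℤ.≤-antisym (proj₂ (on zero)) (proj₁ (on zero))))
    (λ where (_ , on , refl) → OnBoard-∷ {n = n} ℤ.≤-refl ℤ.≤-refl on)

OnBoard-permute : ∀ (π : Permutation′ k) (n : Vec ℕ k) a →
                  OnBoard n a ⇔ OnBoard (permute π n) (permute π a)
OnBoard-permute π n a = mk⇔
  (λ on i → ≡.subst₂ Within (≡.sym (lookup-permute π n i)) (≡.sym (lookup-permute π a i)) (on (π ⟨$⟩ʳ i)))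
  (λ on i → ≡.subst₂ Within (unpermute n i) (unpermute a i) (on (π ⟨$⟩ˡ i)))
  where
  Within : ℕ → ℤ → Set
  Within m x = 1ℤ ℤ.≤ x × x ℤ.≤ + m
  unpermute : ∀ {A : Set} (c : Vec A _) i → lookup (permute π c) (π ⟨$⟩ˡ i) ≡ lookup c i
  unpermute c i = ≡.trans (lookup-permute π c (π ⟨$⟩ˡ i)) (cong (lookup c) (inverseʳ π))

permuteTour : ∀ (π : Permutation′ k) n {es} → BoardTour n es →
              BoardTour (permute π n) (map (mapEdge (permute π)) es)
permuteTour π n = mapTour (permute π) (Step-permute π) (permute-injective π) λ b → mk⇔
  (λ on → permute (flip π) b
        , Equivalence.from (OnBoard-permute π n (permute (flip π) b))
            (subst (OnBoard (permute π n)) (≡.sym (permute-flip π b)) on)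
        , ≡.sym (permute-flip π b))
  (λ where (a , on , refl) → Equivalence.to (OnBoard-permute π n a) on)

-- All gluing happens along the first coordinate; other directions are reduced to it by
-- `permuteTour`.
glueBoards : ∀ {p q} {n : Vec ℕ k} {a b c d es fs} →
             BoardTour (p ∷ n) ((a , b) ∷ es) → BoardTour (q ∷ n) ((c , d) ∷ fs) →
             Step a (translate p c) → Step b (translate p d) →
             BoardTour (p + q ∷ n) (es ++ map (mapEdge (translate p)) fs)
glueBoards {p = p} {q} {n} t t′ =
  glue Step-sym union disjoint t
    (mapTour {W = Above} (translate p) (Step-translate p) (λ {a} {b} → injective {a} {b}) (λ _ → mk⇔ id id) t′)
  where
  -- Described as an image, the translated board satisfies the surjectivity condition of `mapTour`
  -- by definition.
  Above : Vec ℤ _ → Set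
  Above b = ∃ λ a → OnBoard (q ∷ n) a × b ≡ translate p a

  injective : ∀ {a b} → translate p a ≡ translate p b → a ≡ b
  injective {x ∷ a} {y ∷ b} eq with Vec.∷-injective eq
  ... | eq₀ , refl = cong (_∷ a) (AbelianGroupProperties.∙-cancelˡ ℤ.+-0-abelianGroup (+ p) x y eq₀)

  disjoint : ∀ {a} → OnBoard (p ∷ n) a → ¬ Above a
  disjoint on (y ∷ _ , on′ , refl) = ℤ.<-irrefl refl (begin-strict
    + p           <⟨ ℤ.+<+ (ℕ.≤-reflexive (ℕ.+-comm 1 p)) ⟩
    + p ℤ.+ 1ℤ    ≤⟨ ℤ.+-monoʳ-≤ (+ p) (proj₁ (on′ zero)) ⟩
    + p ℤ.+ y     ≤⟨ proj₂ (on zero) ⟩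
    + p           ∎)
    where open ℤ.≤-Reasoning

  split : ∀ x a → 1ℤ ℤ.≤ x × x ℤ.≤ + (p + q) → OnBoard n a → OnBoard (p ∷ n) (x ∷ a) ⊎ Above (x ∷ a)
  split (+ zero) a (+≤+ () , _) on
  split x@(+ suc m) a (lo , +≤+ hi) on with suc m ℕ.≤? p
  ... | yes m≤p = inj₁ (OnBoard-∷ {n = n} lo (+≤+ m≤p) on)
  ... | no  m≰p = inj₂ (+ (suc m ∸ p) ∷ a
    , OnBoard-∷ {n = n} (+≤+ (ℕ.m<n⇒0<n∸m p<m)) (+≤+ (ℕ.m≤n+o⇒m∸n≤o (suc m) p hi)) on
    , cong (λ y → + y ∷ a) (≡.sym (ℕ.m+[n∸m]≡n (ℕ.<⇒≤ p<m))))
    where p<m = ℕ.≰⇒> m≰p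

  union : ∀ a → OnBoard (p + q ∷ n) a ⇔ (OnBoard (p ∷ n) a ⊎ Above a)
  union (x ∷ a) = mk⇔
    (λ on → split x a (on zero) (on ∘ suc))
    Sum.[ (λ on → OnBoard-∷ {n = n} (proj₁ (on zero))
                     (ℤ.≤-trans (proj₂ (on zero)) (+≤+ (ℕ.m≤m+n p q))) (on ∘ suc))
        , (λ where (y ∷ b , on , refl) → OnBoard-∷ {n = n}
                     (ℤ.≤-trans (proj₁ (on zero)) (ℤ.i≤j+i y (+ p)))
                     (ℤ.+-monoʳ-≤ (+ p) (proj₂ (on zero))) (on ∘ suc)) ]′

-- Stacking layers

Parallel : (e f : Vec ℤ k × Vec ℤ k) → Set
Parallel (a , b) (c , d) = DoubleStep a c × DoubleStep b d

record StackableTour (n : Vec ℕ k) : Set where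
  field
    {e e′ f f′} : Vec ℤ k × Vec ℤ k
    e∥e′ : Parallel e e′
    f∥f′ : Parallel f f′
    tour : BoardTour n (e ∷ e′ ∷ f ∷ f′ ∷ [])

permuteStackable : ∀ (π : Permutation′ k) → StackableTour n → StackableTour (permute π n)
permuteStackable {n = n} π t = record
  { e∥e′ = Product.map (DoubleStep-permute π) (DoubleStep-permute π) e∥e′
  ; f∥f′ = Product.map (DoubleStep-permute π) (DoubleStep-permute π) f∥f′
  ; tour = permuteTour π n tour }
  where open StackableTour t

-- Each new layer goes below the others: its `e` is merged with `e′` of the layer above, and its own
-- `e′` stays free for the next one. The pairs `f`, `f′` of the two lowest layers become the two
-- pairs of the result, which is why there are at least two layers.
stack : ∀ m → StackableTour n → StackableTour (2 + m ∷ n)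
stack {k} {n} m t = record
  { e∥e′ = ∥-∷ 1ℤ f∥f′ ; f∥f′ = ∥-∷ (+ 2) f∥f′
  ; tour = select (1st ∷ 1st ∷ 1st ∷ 1st ∷ []) (add (layers m)) }
  where
  open StackableTour t

  at : ℤ → Vec ℤ k × Vec ℤ k → Vec ℤ (suc k) × Vec ℤ (suc k)
  at x = mapEdge (x ∷_)

  ∥-∷ : ∀ x {e e′} → Parallel e e′ → Parallel (at x e) (at x e′)
  ∥-∷ x (p , q) = DoubleStep-∷ x p , DoubleStep-∷ x q

  add : ∀ {m} → BoardTour (suc m ∷ n) (at 1ℤ e′ ∷ at 1ℤ f ∷ at 1ℤ f′ ∷ []) →
        BoardTour (2 + m ∷ n) (at 1ℤ e′ ∷ at 1ℤ f ∷ at 1ℤ f′ ∷ at (+ 2) f ∷ at (+ 2) f′ ∷ [])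
  add t′ = glueBoards {p = 1} (thicken tour) t′
    (DoubleStep⇒Step refl (proj₁ e∥e′)) (DoubleStep⇒Step refl (proj₂ e∥e′))

  layers : ∀ m → BoardTour (suc m ∷ n) (at 1ℤ e′ ∷ at 1ℤ f ∷ at 1ℤ f′ ∷ [])
  layers zero    = select (1st ∷ 1st ∷ 1st ∷ []) (thicken tour)
  layers (suc m) = select (0th ∷ 0th ∷ 0th ∷ []) (add (layers m))

-- From marked tours to Hamiltonian cycles

-- Linkage is stated for an arbitrary continuation, so that subpaths compose and the cycle can be
-- closed by appending its start. The inequality is strict because each mark accounts for one of the
-- edges joining the vertices.
flatten : ∀ {A : Set} {R : A → A → Set} {u v vs es} → Path R u v vs es → ∃ λ ws →
          u ∷ ws ↭ vs × length es < length vs ×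
          (∀ {w ys} → R v w → Linked R (w ∷ ys) → Linked R (u ∷ ws ++ w ∷ ys))
flatten (point u) = [] , refl , s≤s z≤n , _∷_
flatten {R = R} (join {vs = vs} {es = es} p r q) with flatten p | flatten q
... | ws , σ , m , l | ws′ , σ′ , m′ , l′ = ws ++ _ ∷ ws′ , ++⁺ σ σ′ ,
  ≡.subst₂ _<_ (≡.sym (List.length-++ es)) (≡.sym (List.length-++ vs)) (ℕ.+-mono-< m m′) ,
  λ s k → subst (Linked R) (cong (_ ∷_) (≡.sym (List.++-assoc ws _ _))) (l r (l′ s k))
flatten {R = R} (mark {vs = vs} {es = es} e p r j q) with flatten p | flatten q
... | ws , σ , m , l | ws′ , σ′ , m′ , l′ = ws ++ _ ∷ ws′ , ++⁺ σ σ′ ,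
  ≡.subst₂ _<_ (≡.sym (cong suc (List.length-++ es))) (≡.sym (List.length-++ vs)) (ℕ.+-mono-≤-< m m′) ,
  λ s k → subst (Linked R) (cong (_ ∷_) (≡.sym (List.++-assoc ws _ _))) (l r (l′ s k))
flatten (reorder σ τ p) with flatten p
... | ws , ρ , m , l = ws , trans ρ σ , ≡.subst₂ _<_ (↭-length τ) (↭-length σ) m , l

Step⇒KnightMove : ∀ {a b : Vec ℤ k} → Step a b → KnightMove (zipWith ℤ._-_ a b)
Step⇒KnightMove {a = a} {b} (step i j p q r) = i , j ,
  Sum.map (≡.trans (diff i)) (≡.trans (diff i)) (∣∣≡1 p) ,
  Sum.map (≡.trans (diff j)) (≡.trans (diff j)) (∣∣≡2 q) ,
  λ l l≢i l≢j → ≡.trans (diff l) (ℤ.∣i∣≡0⇒i≡0 (r l l≢i l≢j))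
  where
  diff : ∀ l → lookup (zipWith ℤ._-_ a b) l ≡ lookup a l ℤ.- lookup b l
  diff l = Vec.lookup-zipWith ℤ._-_ l a b
  ∣∣≡1 : ∀ {x} → ∣ x ∣ ≡ 1 → x ≡ + 1 ⊎ x ≡ -[1+ 0 ]
  ∣∣≡1 {+ _}      refl = inj₁ refl
  ∣∣≡1 { -[1+ _ ]} refl = inj₂ refl
  ∣∣≡2 : ∀ {x} → ∣ x ∣ ≡ 2 → x ≡ + 2 ⊎ x ≡ -[1+ 1 ]
  ∣∣≡2 {+ _}      refl = inj₁ refl
  ∣∣≡2 { -[1+ _ ]} refl = inj₂ refl

Linked-All : ∀ {A : Set} {P : A → Set} {R : A → A → Set} {xs} → Linked R xs → All P xs →
             Linked (λ a b → P a × P b × R a b) xs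
Linked-All []      _                 = []
Linked-All [-]     _                 = [-]
Linked-All (r ∷ l) (p ∷ ps@(q ∷ _)) = (p , q , r) ∷ Linked-All l ps

closedKnightTour : StackableTour n → ClosedKnightTour n
closedKnightTour {n = n} t with flatten (Tour.path (StackableTour.tour t))
... | ws , σ , m , l = record
  { start = u
  ; rest  = ws
  -- Four marks and the strict inequality give at least five vertices.
  ; atLeast3 = subst (3 ≤_) (≡.sym (↭-length σ)) (ℕ.≤-trans (s≤s (s≤s (s≤s z≤n))) m)
  ; closed = Linked.map (λ (p , q , r) → p , q , Step⇒KnightMove r)
      (Linked-All (l closing [-]) (All.tabulate (onBoard ∘ back)))
  ; distinct = SetoidPermutation.Unique-resp-↭ (≡.setoid _) (↭⇒↭ₛ (↭-sym σ)) (proj₁ spans)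
  ; spanning = λ a → mk⇔ (∈-resp-↭ (↭-sym σ) ∘ Equivalence.to (proj₂ spans a)) onBoard
  }
  where
  open Tour (StackableTour.tour t)
  onBoard : ∀ {a} → a ∈ u ∷ ws → OnBoard n a
  onBoard {a} a∈ = Equivalence.from (proj₂ spans a) (∈-resp-↭ σ a∈)
  back : ∀ {a} → a ∈ u ∷ ws ∷ʳ u → a ∈ u ∷ ws
  back a∈ with ∈-++⁻ (u ∷ ws) a∈
  ... | inj₁ a∈ws        = a∈ws
  ... | inj₂ (here refl) = here refl

-- Verifying a given tour

squares : Vec ℕ k → List (Vec ℤ k)
squares []      = [ [] ]
squares (m ∷ n) = cartesianProductWith (λ i a → (+ suc i) ∷ a) (upTo m) (squares n)

OnBoard⇒∈squares : ∀ (n : Vec ℕ k) {a} → OnBoard n a → a ∈ squares n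
OnBoard⇒∈squares []      {[]}    on = here refl
OnBoard⇒∈squares (m ∷ n) {x ∷ a} on = within x (on zero)
  where
  within : ∀ x → 1ℤ ℤ.≤ x × x ℤ.≤ + m → x ∷ a ∈ squares (m ∷ n)
  within (+ zero)  (+≤+ () , _)
  within (+ suc i) (_ , +≤+ i<m) =
    ∈-cartesianProductWith⁺ (λ i a → (+ suc i) ∷ a) (∈-upTo⁺ i<m) (OnBoard⇒∈squares n (on ∘ suc))

module _ {A : Set} (_≟_ : DecidableEquality A) where

  joins? : ∀ v w e → Dec (Joins e v w)
  joins? v w e = (×-≡-dec _≟_ _≟_ e (v , w)) ⊎-dec (×-≡-dec _≟_ _≟_ e (w , v))

  -- The edges in es that the walk v, ws takes, in the orientation given by es.
  traversed : List (A × A) → A → List A → List (A × A)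
  traversed es v []       = []
  traversed es v (w ∷ ws) with any? (joins? v w) es
  ... | yes e∈ = Any.lookup e∈ ∷ traversed es w ws
  ... | no  _  = traversed es w ws

  -- The last edge, to `x`, is returned separately and unmarked, since it becomes the closing edge
  -- of a tour.
  markedPath : ∀ {R : A → A → Set} es {u} ws {x} → Linked R (u ∷ ws ∷ʳ x) →
               ∃ λ v → Path R u v (u ∷ ws) (traversed es u ws) × R v x
  markedPath es []       (r ∷ [-]) = _ , point _ , r
  markedPath es {u} (w ∷ ws) (r ∷ l) with any? (joins? u w) es | markedPath es ws l
  ... | yes e∈ | v , p , r′ = v , mark _ (point _) r (lookup-result e∈) p , r′
  ... | no  _  | v , p , r′ = v , join (point _) r p , r′

_≟ᵥ_ : DecidableEquality (Vec ℤ k)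
_≟ᵥ_ = Vec.≡-dec ℤ._≟_

find⊑ : {A : Set} → DecidableEquality A → (xs ys : List A) → Maybe (xs ⊑ ys)
find⊑ _≟_ []       ys = just []
find⊑ _≟_ (x ∷ xs) ys with any? (x ≟_) ys
... | yes x∈ys = Maybe.map (x∈ys ∷_) (find⊑ _≟_ xs (ys ─ x∈ys))
... | no  _    = nothing

step? : Decidable (Step {k})
step? a b = map′ (λ (i , j , p , q , r) → step i j p q r) (λ (step i j p q r) → i , j , p , q , r)
  (Fin.any? λ i → Fin.any? λ j →
    (gap (lookup a i) (lookup b i) ℕ.≟ 1) ×-dec (gap (lookup a j) (lookup b j) ℕ.≟ 2) ×-dec
    Fin.all? λ l → ¬? (l Fin.≟ i) →-dec ¬? (l Fin.≟ j) →-dec (gap (lookup a l) (lookup b l) ℕ.≟ 0))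

doubleStep? : Decidable (DoubleStep {k})
doubleStep? a b = map′ (λ (j , q , r) → doubleStep j q r) (λ (doubleStep j q r) → j , q , r)
  (Fin.any? λ j → (gap (lookup a j) (lookup b j) ℕ.≟ 2) ×-dec
    Fin.all? λ l → ¬? (l Fin.≟ j) →-dec (gap (lookup a l) (lookup b l) ℕ.≟ 0))

parallel? : Decidable (Parallel {k})
parallel? (a , b) (c , d) = doubleStep? a c ×-dec doubleStep? b d

onBoard? : ∀ (n : Vec ℕ k) a → Dec (OnBoard n a)
onBoard? n a = Fin.all? λ i → (1ℤ ℤ.≤? lookup a i) ×-dec (lookup a i ℤ.≤? + lookup n i)

-- On a concrete board every condition is settled by evaluation. As the closing edge carries no
-- mark, the starting square must be chosen so that the edge back to it is not among the required
-- marks.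
checkTour : ∀ (n : Vec ℕ k) {es} u ws →
            {True (Linked.linked? step? (u ∷ ws ∷ʳ u))} →
            {True (DecUnique.unique? _≟ᵥ_ (u ∷ ws))} →
            {True (all? (onBoard? n) (u ∷ ws))} →
            {True (all? (λ a → DecMembership._∈?_ _≟ᵥ_ a (u ∷ ws)) (squares n))} →
            {T (is-just (find⊑ (×-≡-dec _≟ᵥ_ _≟ᵥ_) es (traversed _≟ᵥ_ es u ws)))} →
            BoardTour n es
checkTour n {es} u ws {linked} {unique} {on} {all} {marks}
  with markedPath _≟ᵥ_ es ws (toWitness linked)
... | _ , p , r = select (to-witness-T _ marks) record
  { path    = reorder refl (↭-reflexive (≡.sym (List.++-identityʳ _))) p
  ; closing = r
  ; spans   = toWitness unique , λ a → mk⇔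
      (λ on → All.lookup (toWitness all) (OnBoard⇒∈squares n on))
      (All.lookup (toWitness on))
  }

-- Boards of dimension three

-- The coordinates are the decimal digits.
square : ℕ → Vec ℤ 3
square m = + (m / 100) ∷ + (m / 10 % 10) ∷ + (m % 10) ∷ []

⟨_,_,_⟩ : ℕ → ℕ → ℕ → Vec ℤ 3
⟨ x , y , z ⟩ = + x ∷ + y ∷ + z ∷ []

-- The first three edges lie in the far faces x = a, y = b and z = c. Beyond
-- such a face the fourth, seventh and fifth edge, respectively, of the next
-- board are a knight move away. The last four edges form two parallel pairs.
marks : ℕ → ℕ → ℕ → List (Vec ℤ 3 × Vec ℤ 3)
marks a b c =
    (⟨ a , 1 , 3 ⟩ , ⟨ a , 2 , 1 ⟩)
  ∷ (⟨ 2 , b , 3 ⟩ , ⟨ 1 , b , 1 ⟩)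
  ∷ (⟨ 1 , 1 , c ⟩ , ⟨ 2 , 3 , c ⟩)
  ∷ (⟨ 1 , 1 , 1 ⟩ , ⟨ 2 , 3 , 1 ⟩)
  ∷ (⟨ 1 , 3 , 1 ⟩ , ⟨ 2 , 1 , 1 ⟩)
  ∷ (⟨ 1 , 2 , 1 ⟩ , ⟨ 2 , 2 , 3 ⟩)
  ∷ (⟨ 1 , 2 , 3 ⟩ , ⟨ 2 , 2 , 1 ⟩)
  ∷ []

-- The invariant of gluing in all three directions: the mark in the far face along the direction of
-- gluing comes from the second board, all others from the first.
Good : ℕ → ℕ → ℕ → Set
Good a b c = BoardTour (a ∷ b ∷ c ∷ []) (marks a b c)

gap-+ : ∀ m d → gap (+ m) (+ (m + d)) ≡ d
gap-+ m d = begin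
  gap (+ m) (+ (m + d))                ≡⟨ cong (λ x → gap x (+ (m + d))) (ℤ.+-identityʳ (+ m)) ⟨
  gap (+ m ℤ.+ 0ℤ) (+ m ℤ.+ + d)       ≡⟨ gap-translate (+ m) 0ℤ (+ d) ⟩
  gap 0ℤ (+ d)                         ≡⟨ cong ∣_∣ (ℤ.+-identityˡ (ℤ.- + d)) ⟩
  ∣ ℤ.- + d ∣                          ≡⟨ ℤ.∣-i∣≡∣i∣ (+ d) ⟩
  d                                    ∎
  where open ≡-Reasoning

climb1 : ∀ m {a b : Vec ℤ k} → {double : True (doubleStep? a b)} → Step (+ m ∷ a) (+ (m + 1) ∷ b)
climb1 m {double = double} = DoubleStep⇒Step (gap-+ m 1) (toWitness double)

climb2 : ∀ m {y z y′ z′} → gap y y′ ≡ 1 → gap z z′ ≡ 0 → Step (+ m ∷ y ∷ z ∷ []) (+ (m + 2) ∷ y′ ∷ z′ ∷ [])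
climb2 m p q = step (suc zero) zero p (gap-+ m 2) λ where
  zero _ l≢ → contradiction refl l≢
  (suc zero) l≢ _ → contradiction refl l≢
  (suc (suc zero)) _ _ → q

-- The crossings lead from (a,1,3) to (a+1,1,1) and from (a,2,1) to (a+2,3,1). The far mark of the
-- second board ends up last and is moved back to its place; indices count the marks not yet picked.
glueX : ∀ {a a′ b c} → Good a b c → Good a′ b c → Good (a + a′) b c
glueX {a} t t′ = select (6th ∷ 0th ∷ 0th ∷ 0th ∷ 0th ∷ 0th ∷ 0th ∷ [])
  (glueBoards t (select (3rd ∷ 0th ∷ []) t′) (climb1 a) (climb2 a refl refl))

-- The transposition is its own inverse, so applying it again restores the order of coordinates. The
-- crossings lead from (2,b,3) to (1,b+2,3) and from (1,b,1) to (2,b+2,1).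
glueY : ∀ {a b b′ c} → Good a b c → Good a b′ c → Good a (b + b′) c
glueY {a} {b} {b′} {c} t t′ = permuteTour π (b + b′ ∷ a ∷ c ∷ [])
  (select (0th ∷ 5th ∷ 0th ∷ 0th ∷ 0th ∷ 0th ∷ 0th ∷ [])
    (glueBoards (select (1st ∷ 0th ∷ 0th ∷ 0th ∷ 0th ∷ 0th ∷ 0th ∷ []) (permuteTour π (a ∷ b ∷ c ∷ []) t))
                (select (6th ∷ 1st ∷ []) (permuteTour π (a ∷ b′ ∷ c ∷ []) t′))
                (climb2 b refl refl) (climb2 b refl refl)))
  where π = transpose zero (suc zero)

-- The crossings lead from (1,1,c) to (1,3,c+1) and from (2,3,c) to (2,1,c+1).
glueZ : ∀ {a b c c′} → Good a b c → Good a b c′ → Good a b (c + c′)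
glueZ {a} {b} {c} {c′} t t′ = permuteTour π (c + c′ ∷ b ∷ a ∷ [])
  (select (0th ∷ 0th ∷ 4th ∷ 0th ∷ 0th ∷ 0th ∷ 0th ∷ [])
    (glueBoards (select (2nd ∷ 0th ∷ 0th ∷ 0th ∷ 0th ∷ 0th ∷ 0th ∷ []) (permuteTour π (a ∷ b ∷ c ∷ []) t))
                (select (4th ∷ 2nd ∷ []) (permuteTour π (a ∷ b ∷ c′ ∷ []) t′))
                (climb1 c) (climb1 c)))
  where π = transpose zero (suc (suc zero))

tour234 : Good 2 3 4
tour234 = checkTour (2 ∷ 3 ∷ 4 ∷ []) (square 111) (map square
  ( 231 ∷ 223 ∷ 121 ∷ 113 ∷ 211 ∷ 131 ∷ 233 ∷ 212 ∷ 224 ∷ 122 ∷ 134 ∷ 232 ∷ 112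
  ∷ 214 ∷ 222 ∷ 124 ∷ 132 ∷ 234 ∷ 114 ∷ 133 ∷ 213 ∷ 221 ∷ 123 ∷ []))

tour235 : Good 2 3 5
tour235 = checkTour (2 ∷ 3 ∷ 5 ∷ []) (square 111) (map square
  ( 231 ∷ 212 ∷ 224 ∷ 122 ∷ 134 ∷ 113 ∷ 125 ∷ 223 ∷ 121 ∷ 133 ∷ 114 ∷ 135 ∷ 215
  ∷ 234 ∷ 222 ∷ 214 ∷ 235 ∷ 115 ∷ 123 ∷ 221 ∷ 213 ∷ 225 ∷ 233 ∷ 131 ∷ 211 ∷ 232 ∷ 112
  ∷ 124 ∷ 132 ∷ []))

tour236 : Good 2 3 6
tour236 = checkTour (2 ∷ 3 ∷ 6 ∷ []) (square 123) (map square
  ( 221 ∷ 213 ∷ 225 ∷ 233 ∷ 131 ∷ 211 ∷ 232 ∷ 112 ∷ 124 ∷ 226 ∷ 234 ∷ 222 ∷ 214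
  ∷ 235 ∷ 115 ∷ 136 ∷ 216 ∷ 114 ∷ 122 ∷ 134 ∷ 126 ∷ 224 ∷ 236 ∷ 116 ∷ 135 ∷ 215 ∷ 223
  ∷ 121 ∷ 133 ∷ 125 ∷ 113 ∷ 132 ∷ 212 ∷ 231 ∷ 111 ∷ []))

tour237 : Good 2 3 7
tour237 = checkTour (2 ∷ 3 ∷ 7 ∷ []) (square 123) (map square
  ( 221 ∷ 213 ∷ 133 ∷ 112 ∷ 214 ∷ 222 ∷ 124 ∷ 226 ∷ 234 ∷ 132 ∷ 113 ∷ 121 ∷ 223
  ∷ 125 ∷ 227 ∷ 215 ∷ 236 ∷ 116 ∷ 135 ∷ 127 ∷ 115 ∷ 136 ∷ 117 ∷ 237 ∷ 216 ∷ 235 ∷ 137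
  ∷ 217 ∷ 225 ∷ 233 ∷ 131 ∷ 211 ∷ 232 ∷ 134 ∷ 126 ∷ 114 ∷ 122 ∷ 224 ∷ 212 ∷ 231 ∷ 111 ∷ []))

tour243 : Good 2 4 3
tour243 = checkTour (2 ∷ 4 ∷ 3 ∷ []) (square 111) (map square
  ( 231 ∷ 212 ∷ 132 ∷ 113 ∷ 233 ∷ 241 ∷ 143 ∷ 131 ∷ 211 ∷ 232 ∷ 112 ∷ 133 ∷ 121
  ∷ 223 ∷ 242 ∷ 122 ∷ 141 ∷ 243 ∷ 222 ∷ 142 ∷ 123 ∷ 221 ∷ 213 ∷ []))

tour244 : Good 2 4 4
tour244 = checkTour (2 ∷ 4 ∷ 4 ∷ []) (square 111) (map square
  ( 231 ∷ 223 ∷ 121 ∷ 142 ∷ 244 ∷ 232 ∷ 134 ∷ 122 ∷ 242 ∷ 234 ∷ 114 ∷ 212 ∷ 224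
  ∷ 144 ∷ 132 ∷ 113 ∷ 211 ∷ 131 ∷ 233 ∷ 241 ∷ 143 ∷ 124 ∷ 222 ∷ 214 ∷ 112 ∷ 133 ∷ 141
  ∷ 243 ∷ 123 ∷ 221 ∷ 213 ∷ []))

tour245 : Good 2 4 5
tour245 = checkTour (2 ∷ 4 ∷ 5 ∷ []) (square 111) (map square
  ( 231 ∷ 212 ∷ 132 ∷ 144 ∷ 242 ∷ 234 ∷ 114 ∷ 122 ∷ 141 ∷ 243 ∷ 222 ∷ 241 ∷ 121
  ∷ 223 ∷ 215 ∷ 135 ∷ 143 ∷ 124 ∷ 145 ∷ 133 ∷ 112 ∷ 214 ∷ 235 ∷ 115 ∷ 134 ∷ 142 ∷ 244
  ∷ 225 ∷ 233 ∷ 113 ∷ 125 ∷ 245 ∷ 224 ∷ 232 ∷ 211 ∷ 131 ∷ 123 ∷ 221 ∷ 213 ∷ []))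

tour253 : Good 2 5 3
tour253 = checkTour (2 ∷ 5 ∷ 3 ∷ []) (square 213) (map square
  ( 221 ∷ 123 ∷ 243 ∷ 251 ∷ 153 ∷ 141 ∷ 122 ∷ 242 ∷ 223 ∷ 121 ∷ 142 ∷ 222 ∷ 241
  ∷ 143 ∷ 151 ∷ 253 ∷ 232 ∷ 112 ∷ 133 ∷ 152 ∷ 131 ∷ 211 ∷ 113 ∷ 233 ∷ 252 ∷ 132 ∷ 212
  ∷ 231 ∷ 111 ∷ []))

tour254 : Good 2 5 4
tour254 = checkTour (2 ∷ 5 ∷ 4 ∷ []) (square 111) (map square
  ( 231 ∷ 252 ∷ 244 ∷ 223 ∷ 121 ∷ 241 ∷ 253 ∷ 151 ∷ 143 ∷ 124 ∷ 112 ∷ 133 ∷ 141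
  ∷ 243 ∷ 251 ∷ 153 ∷ 233 ∷ 214 ∷ 222 ∷ 142 ∷ 154 ∷ 234 ∷ 114 ∷ 212 ∷ 224 ∷ 122 ∷ 134
  ∷ 232 ∷ 152 ∷ 254 ∷ 242 ∷ 144 ∷ 132 ∷ 113 ∷ 211 ∷ 131 ∷ 123 ∷ 221 ∷ 213 ∷ []))

tour255 : Good 2 5 5
tour255 = checkTour (2 ∷ 5 ∷ 5 ∷ []) (square 132) (map square
  ( 144 ∷ 125 ∷ 113 ∷ 211 ∷ 131 ∷ 251 ∷ 232 ∷ 152 ∷ 133 ∷ 141 ∷ 243 ∷ 123 ∷ 221
  ∷ 213 ∷ 115 ∷ 235 ∷ 214 ∷ 112 ∷ 124 ∷ 145 ∷ 225 ∷ 244 ∷ 252 ∷ 154 ∷ 142 ∷ 222 ∷ 241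
  ∷ 121 ∷ 223 ∷ 242 ∷ 254 ∷ 134 ∷ 153 ∷ 255 ∷ 135 ∷ 215 ∷ 234 ∷ 114 ∷ 122 ∷ 224 ∷ 212
  ∷ 233 ∷ 245 ∷ 143 ∷ 155 ∷ 253 ∷ 151 ∷ 231 ∷ 111 ∷ []))

tour433 : Good 4 3 3
tour433 = checkTour (4 ∷ 3 ∷ 3 ∷ []) (square 132) (map square
  ( 212 ∷ 422 ∷ 221 ∷ 123 ∷ 322 ∷ 112 ∷ 133 ∷ 323 ∷ 122 ∷ 332 ∷ 313 ∷ 411 ∷ 423
  ∷ 213 ∷ 232 ∷ 431 ∷ 412 ∷ 433 ∷ 331 ∷ 211 ∷ 131 ∷ 233 ∷ 113 ∷ 121 ∷ 223 ∷ 321 ∷ 333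
  ∷ 312 ∷ 432 ∷ 222 ∷ 421 ∷ 413 ∷ 311 ∷ 231 ∷ 111 ∷ []))

tour633 : Good 6 3 3
tour633 = checkTour (6 ∷ 3 ∷ 3 ∷ []) (square 123) (map square
  ( 221 ∷ 411 ∷ 432 ∷ 622 ∷ 423 ∷ 222 ∷ 412 ∷ 213 ∷ 333 ∷ 532 ∷ 331 ∷ 312 ∷ 522
  ∷ 321 ∷ 122 ∷ 323 ∷ 513 ∷ 433 ∷ 623 ∷ 611 ∷ 632 ∷ 613 ∷ 621 ∷ 633 ∷ 612 ∷ 631 ∷ 533
  ∷ 521 ∷ 311 ∷ 431 ∷ 232 ∷ 422 ∷ 212 ∷ 332 ∷ 531 ∷ 512 ∷ 313 ∷ 112 ∷ 133 ∷ 121 ∷ 223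
  ∷ 211 ∷ 131 ∷ 233 ∷ 113 ∷ 132 ∷ 322 ∷ 523 ∷ 511 ∷ 413 ∷ 421 ∷ 231 ∷ 111 ∷ []))

-- The 2×3×3 board has no tour, so the base lengths are 4 to 7 and the increment is 4.
good23 : ∀ c → Good 2 3 (4 + c)
good23 0 = tour234
good23 1 = tour235
good23 2 = tour236
good23 3 = tour237
good23 (suc (suc (suc (suc c)))) = glueZ {c = 4} tour234 (good23 c)

-- Length 3 is possible here and for `good25`, so three base cases and the increment 3 suffice.
good24 : ∀ c → Good 2 4 (3 + c)
good24 0 = tour243
good24 1 = tour244
good24 2 = tour245
good24 (suc (suc (suc c))) = glueZ {c = 3} tour243 (good24 c)

good25 : ∀ c → Good 2 5 (3 + c)
good25 0 = tour253
good25 1 = tour254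
good25 2 = tour255
good25 (suc (suc (suc c))) = glueZ {c = 3} tour253 (good25 c)

good2 : ∀ b c → Good 2 (3 + b) (4 + c)
good2 0 c = good23 c
good2 1 c = good24 (suc c)
good2 2 c = good25 (suc c)
-- Slabs of width 3 reduce the second side to 3, 4 or 5.
good2 (suc (suc (suc b))) c = glueY {b = 3} (good23 c) (good2 b c)

good : ∀ a b c → Good (suc a * 2) (3 + b) (4 + c)
good zero    b c = good2 b c
good (suc a) b c = glueX {a = 2} (good2 b c) (good a b c)

-- This covers two sides equal to 3, out of reach of `good`. Again 2×3×3 is impossible, so the bases
-- are 4 and 6 and the increment is 4.
good33 : ∀ a → Good ((2 + a) * 2) 3 3
good33 0 = tour433
good33 1 = tour633
good33 (suc (suc a)) = glueX {a = 4} tour433 (good33 a)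

stackable : ∀ {a b c} → Good a b c → StackableTour (a ∷ b ∷ c ∷ [])
stackable t = record
  { e∥e′ = toWitness {a? = parallel? _ _} _
  ; f∥f′ = toWitness {a? = parallel? _ _} _
  ; tour = select (3rd ∷ 3rd ∷ 3rd ∷ 3rd ∷ []) t }

-- Boards with an even side

evenBox : ∀ {x y z} → 2 ∣ x → 2 ≤ x → 3 ≤ y → 4 ≤ z → StackableTour (x ∷ y ∷ z ∷ [])
evenBox (divides (suc a) refl) _ (s≤s (s≤s (s≤s {n = b} _))) (s≤s (s≤s (s≤s (s≤s {n = c} _)))) =
  stackable (good a b c)

swapFirst : ∀ {x y} → StackableTour (y ∷ x ∷ n) → StackableTour (x ∷ y ∷ n)
swapFirst {n = n} t = subst (λ n → StackableTour (_ ∷ _ ∷ n)) (Vec.tabulate∘lookup n)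
  (permuteStackable (transpose zero (suc zero)) t)

swapLast : ∀ {x y z} → StackableTour (x ∷ z ∷ y ∷ []) → StackableTour (x ∷ y ∷ z ∷ [])
swapLast = permuteStackable (transpose (suc zero) (suc (suc zero)))

evenBox33 : ∀ {z} → 2 ∣ z → 4 ≤ z → StackableTour (3 ∷ 3 ∷ z ∷ [])
evenBox33 (divides 0 refl) ()
evenBox33 (divides 1 refl) (s≤s (s≤s ()))
evenBox33 (divides (suc (suc a)) refl) _ = swapLast (swapFirst (stackable (good33 a)))

-- Once the even side is in front, `evenBox` needs one of the others to be at least 4, which fails
-- only if both are 3.
evenLast : ∀ {x y z} → 2 ∣ z → 3 ≤ x → x ≤ y → 4 ≤ z → StackableTour (x ∷ y ∷ z ∷ [])
evenLast even 3≤x x≤y 4≤z with ℕ.m≤n⇒m<n∨m≡n (ℕ.≤-trans 3≤x x≤y)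
... | inj₁ 4≤y  = swapLast (swapFirst (evenBox even (ℕ.≤-trans (s≤s (s≤s z≤n)) 4≤z) 3≤x 4≤y))
... | inj₂ refl with refl ← ℕ.≤-antisym x≤y 3≤x = evenBox33 even 4≤z

box : ∀ {x y z} i → 2 ∣ lookup (x ∷ y ∷ z ∷ []) i → 2 ≤ x → x ≤ y → 3 ≤ y → 4 ≤ z →
      StackableTour (x ∷ y ∷ z ∷ [])
box i even 2≤x x≤y 3≤y 4≤z with ℕ.m≤n⇒m<n∨m≡n 2≤x
-- The first side is 2 and serves as the even one.
box i                even 2≤x x≤y 3≤y 4≤z | inj₂ refl = evenBox (divides 1 refl) 2≤x 3≤y 4≤z
box zero             even 2≤x x≤y 3≤y 4≤z | inj₁ 3≤x  = evenBox even 2≤x 3≤y 4≤z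
box (suc zero)       even 2≤x x≤y 3≤y 4≤z | inj₁ 3≤x  = swapFirst (evenBox even (ℕ.<⇒≤ 3≤y) 3≤x 4≤z)
box (suc (suc zero)) even 2≤x x≤y 3≤y 4≤z | inj₁ 3≤x  = evenLast even 3≤x x≤y 4≤z

stack′ : ∀ {m} → 2 ≤ m → StackableTour n → StackableTour (m ∷ n)
stack′ (s≤s (s≤s {n = m} _)) = stack m

-- The sides between the even one and the last two are added by stacking, and a swap moves the even
-- side past each of them.
evenFirst : ∀ m (n : Vec ℕ (2 + m)) {x} → 2 ∣ x → 2 ≤ x → (∀ i → 2 ≤ lookup n i) →
            3 ≤ lookup n (inject₁ (fromℕ m)) → 4 ≤ lookup n (fromℕ (1 + m)) → StackableTour (x ∷ n)
evenFirst zero    (y ∷ z ∷ []) even 2≤x 2≤n 3≤y 4≤z = evenBox even 2≤x 3≤y 4≤z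
evenFirst (suc m) (y ∷ n)      even 2≤x 2≤n 3≤y 4≤z =
  swapFirst (stack′ (2≤n zero) (evenFirst m n even 2≤x (2≤n ∘ suc) 3≤y 4≤z))

-- Leading sides are split off for stacking until the even side comes first or three sides are left.
-- The last two sides, with their bounds 3 and 4, always survive.
construct : ∀ m (n : Vec ℕ (3 + m)) i → 2 ∣ lookup n i → (∀ i → 2 ≤ lookup n i) →
            lookup n Preserves Fin._≤_ ⟶ _≤_ →
            3 ≤ lookup n (inject₁ (fromℕ (1 + m))) → 4 ≤ lookup n (fromℕ (2 + m)) → StackableTour n
construct m       (x ∷ n) zero    even 2≤n _    = evenFirst m n even (2≤n zero) (2≤n ∘ suc)
construct zero    (x ∷ y ∷ z ∷ []) (suc i) even 2≤n mono = box (suc i) even (2≤n zero) (mono {zero} {suc zero} z≤n)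
construct (suc m) (x ∷ n) (suc i) even 2≤n mono 3≤ 4≤ =
  stack′ (2≤n zero) (construct m n i even (2≤n ∘ suc) (λ i≤j → mono (s≤s i≤j)) 3≤ 4≤)

-- Boards without a tour

parityℤ : ℤ → Parity
parityℤ x = parity ∣ x ∣

parity-⊖ : ∀ m n → parityℤ (m ℤ.⊖ n) ≡ parity m ℙ.+ parity n
parity-⊖ m       zero    = ≡.sym (ℙ.+-identityʳ (parity m))
parity-⊖ zero    (suc n) = refl
parity-⊖ (suc m) (suc n) = begin
  parityℤ (suc m ℤ.⊖ suc n)               ≡⟨ cong parityℤ (ℤ.[1+m]⊖[1+n]≡m⊖n m n) ⟩
  parityℤ (m ℤ.⊖ n)                       ≡⟨ parity-⊖ m n ⟩
  parity m ℙ.+ parity n                   ≡⟨ cong₂ ℙ._+_ (ℙ.suc-homo-⁻¹ m) (ℙ.suc-homo-⁻¹ n) ⟨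
  parity (suc m) ⁻¹ ℙ.+ parity (suc n) ⁻¹ ≡⟨ cancel (parity (suc m)) (parity (suc n)) ⟩
  parity (suc m) ℙ.+ parity (suc n)       ∎
  where
  open ≡-Reasoning
  cancel : ∀ p q → p ⁻¹ ℙ.+ q ⁻¹ ≡ p ℙ.+ q
  cancel 0ℙ 0ℙ = refl
  cancel 0ℙ 1ℙ = refl
  cancel 1ℙ 0ℙ = refl
  cancel 1ℙ 1ℙ = refl

parity-+ : ∀ x y → parityℤ (x ℤ.+ y) ≡ parityℤ x ℙ.+ parityℤ y
parity-+ (+ m)    (+ n)    = ℙ.+-homo-+ m n
parity-+ (+ m)    -[1+ n ] = parity-⊖ m (suc n)
parity-+ -[1+ m ] (+ n)    = ≡.trans (parity-⊖ n (suc m)) (ℙ.+-comm (parity n) _)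
parity-+ -[1+ m ] -[1+ n ] = ≡.trans (cong (parity ∘ suc) (≡.sym (ℕ.+-suc m n))) (ℙ.+-homo-+ (suc m) (suc n))

-- Modulo 2, subtraction is addition.
parity-- : ∀ x y → parityℤ (x ℤ.- y) ≡ parityℤ x ℙ.+ parityℤ y
parity-- x y = ≡.trans (parity-+ x (ℤ.- y)) (cong (λ m → parityℤ x ℙ.+ parity m) (ℤ.∣-i∣≡∣i∣ y))

colour : Vec ℤ k → Parity
colour []      = 0ℙ
colour (x ∷ a) = parityℤ x ℙ.+ colour a

colour-difference : ∀ (a b : Vec ℤ k) → colour (zipWith ℤ._-_ a b) ≡ colour a ℙ.+ colour b
colour-difference []      []      = refl
colour-difference (x ∷ a) (y ∷ b) = ≡.trans
  (cong₂ ℙ._+_ (parity-- x y) (colour-difference a b))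
  (CommutativeSemigroupProperties.interchange ℙ.+-commutativeSemigroup
    (parityℤ x) (parityℤ y) (colour a) (colour b))

colour-even : ∀ (c : Vec ℤ k) → (∀ l → parityℤ (lookup c l) ≡ 0ℙ) → colour c ≡ 0ℙ
colour-even []      even = refl
colour-even (x ∷ c) even = cong₂ ℙ._+_ (even zero) (colour-even c (even ∘ suc))

colour-odd : ∀ (c : Vec ℤ k) i → parityℤ (lookup c i) ≡ 1ℙ →
             (∀ l → l ≢ i → parityℤ (lookup c l) ≡ 0ℙ) → colour c ≡ 1ℙ
colour-odd (x ∷ c) zero    odd even = cong₂ ℙ._+_ odd (colour-even c λ l → even (suc l) λ ())
colour-odd (x ∷ c) (suc i) odd even =
  cong₂ ℙ._+_ (even zero λ ()) (colour-odd c i odd λ l l≢i → even (suc l) (l≢i ∘ Fin.suc-injective))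

±2 : ℤ → Set
±2 x = x ≡ + 2 ⊎ x ≡ -[1+ 1 ]

±2-even : ∀ {x} → ±2 x → parityℤ x ≡ 0ℙ
±2-even (inj₁ refl) = refl
±2-even (inj₂ refl) = refl

colour-KnightMove : ∀ (c : Vec ℤ k) → KnightMove c → colour c ≡ 1ℙ
colour-KnightMove c (i , j , one , two , zeros) = colour-odd c i (odd one) even
  where
  odd : ∀ {x} → x ≡ + 1 ⊎ x ≡ -[1+ 0 ] → parityℤ x ≡ 1ℙ
  odd (inj₁ refl) = refl
  odd (inj₂ refl) = refl
  even : ∀ l → l ≢ i → parityℤ (lookup c l) ≡ 0ℙ
  even l l≢i with l Fin.≟ j
  ... | yes refl = ±2-even two
  ... | no  l≢j  = cong parityℤ (zeros l l≢i l≢j)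

module _ {A : Set} {R : A → A → Set} (f : A → Parity) where

  -- A walk from `u` to `v` has as many edges as `u ∷ ws` has entries, and each edge contributes 1;
  -- the values at inner vertices cancel. For `v` equal to `u` this forces a cycle to have even
  -- length.
  alternating : (∀ a b → R a b → f a ℙ.+ f b ≡ 1ℙ) →
                ∀ {u} ws {v} → Linked R (u ∷ ws ∷ʳ v) → f u ℙ.+ f v ≡ parity (length (u ∷ ws))
  alternating flips []       (r ∷ [-]) = flips _ _ r
  alternating flips {u} (w ∷ ws) {v} (r ∷ l) = begin
    f u ℙ.+ f v                           ≡⟨ cong (f u ℙ.+_) (cong (ℙ._+ f v) (ℙ.p+p≡0ℙ (f w))) ⟨
    f u ℙ.+ (f w ℙ.+ f w ℙ.+ f v)         ≡⟨ cong (f u ℙ.+_) (ℙ.+-assoc (f w) (f w) (f v)) ⟩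
    f u ℙ.+ (f w ℙ.+ (f w ℙ.+ f v))       ≡⟨ ℙ.+-assoc (f u) (f w) _ ⟨
    f u ℙ.+ f w ℙ.+ (f w ℙ.+ f v)         ≡⟨ cong₂ ℙ._+_ (flips _ _ r) (alternating flips ws l) ⟩
    (parity (length (w ∷ ws))) ⁻¹         ≡⟨ ℙ.suc-homo-⁻¹ (length ws) ⟩
    parity (length ws)                    ∎
    where open ≡-Reasoning

  constant : (∀ a b → R a b → f a ≡ f b) →
             ∀ {u ws} → Linked R (u ∷ ws) → ∀ {a} → a ∈ u ∷ ws → f a ≡ f u
  constant same l       (here refl) = refl
  constant same (r ∷ l) (there a∈)  = ≡.trans (constant same l a∈) (≡.sym (same _ _ r))

length-cartesianProductWith : ∀ {A B C : Set} (f : A → B → C) xs ys →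
                              length (cartesianProductWith f xs ys) ≡ length xs * length ys
length-cartesianProductWith f []       ys = refl
length-cartesianProductWith f (x ∷ xs) ys = ≡.trans (List.length-++ (map (f x) ys))
  (cong₂ _+_ (List.length-map (f x) ys) (length-cartesianProductWith f xs ys))

squares-unique : ∀ (n : Vec ℕ k) → Unique (squares n)
squares-unique []      = [] ∷ []
squares-unique (m ∷ n) = Unique.cartesianProductWith⁺ _
  (λ eq → let eq₀ , eqs = Vec.∷-injective eq in ℕ.suc-injective (ℤ.+-injective eq₀) , eqs)
  (Unique.upTo⁺ m) (squares-unique n)

∈squares⇒OnBoard : ∀ (n : Vec ℕ k) {a} → a ∈ squares n → OnBoard n a
∈squares⇒OnBoard []      a∈ ()
∈squares⇒OnBoard (m ∷ n) a∈ with ∈-cartesianProductWith⁻ _ (upTo m) (squares n) a∈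
... | i , b , i∈ , b∈ , refl =
  OnBoard-∷ {n = n} (+≤+ (s≤s z≤n)) (+≤+ (∈-upTo⁻ i∈)) (∈squares⇒OnBoard n b∈)

odd⇒parity : ∀ m → 2 ∤ m → parity m ≡ 1ℙ
odd⇒parity 0 odd = contradiction (divides 0 refl) odd
odd⇒parity 1 odd = refl
odd⇒parity (suc (suc m)) odd = odd⇒parity m λ where (divides q refl) → odd (divides (suc q) refl)

parity-squares : ∀ (n : Vec ℕ k) → (∀ i → 2 ∤ lookup n i) → parity (length (squares n)) ≡ 1ℙ
parity-squares []      odd = refl
parity-squares (m ∷ n) odd = begin
  parity (length (squares (m ∷ n)))              ≡⟨ cong parity (length-cartesianProductWith _ (upTo m) (squares n)) ⟩
  parity (length (upTo m) * length (squares n))  ≡⟨ ℙ.*-homo-* (length (upTo m)) _ ⟩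
  parity (length (upTo m)) ℙ.* parity (length (squares n))
    ≡⟨ cong₂ ℙ._*_ (≡.trans (cong parity (List.length-upTo m)) (odd⇒parity m (odd zero))) (parity-squares n (odd ∘ suc)) ⟩
  1ℙ ∎
  where open ≡-Reasoning

allOdd⇒noTour : ∀ (n : Vec ℕ k) → (∀ i → 2 ∤ lookup n i) → ¬ ClosedKnightTour n
allOdd⇒noTour n odd tour = contradiction 0≡1 λ ()
  where
  open HamiltonianCycle tour
  open ≡-Reasoning
  flips : ∀ a b → Graph.Edge (knightGraph n) a b → colour a ℙ.+ colour b ≡ 1ℙ
  flips a b (_ , _ , move) = ≡.trans (≡.sym (colour-difference a b)) (colour-KnightMove (zipWith ℤ._-_ a b) move)
  0≡1 : 0ℙ ≡ 1ℙ
  0≡1 = begin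
    0ℙ                                ≡⟨ ℙ.p+p≡0ℙ (colour start) ⟨
    colour start ℙ.+ colour start     ≡⟨ alternating colour flips rest closed ⟩
    -- The tour and `squares n` list the same set without repetition, hence are permutations of each
    -- other.
    parity (length (start ∷ rest))    ≡⟨ cong parity (↭-length (∼bag⇒↭ (unique∧set⇒bag distinct (squares-unique n)
      (mk⇔ (λ a∈ → OnBoard⇒∈squares n (Equivalence.from (spanning _) a∈))
           (λ a∈ → Equivalence.to (spanning _) (∈squares⇒OnBoard n a∈)))))) ⟩
    parity (length (squares n))       ≡⟨ parity-squares n odd ⟩
    1ℙ                                ∎

within-2 : ∀ {x y} → 1ℤ ℤ.≤ x × x ℤ.≤ + 2 → 1ℤ ℤ.≤ y × y ℤ.≤ + 2 → ¬ ±2 (x ℤ.- y)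
within-2 {+ 1} {+ 1} _ _ = Sum.[ (λ ()) , (λ ()) ]
within-2 {+ 1} {+ 2} _ _ = Sum.[ (λ ()) , (λ ()) ]
within-2 {+ 2} {+ 1} _ _ = Sum.[ (λ ()) , (λ ()) ]
within-2 {+ 2} {+ 2} _ _ = Sum.[ (λ ()) , (λ ()) ]
within-2 {+ 0} (+≤+ () , _)
within-2 {y = + 0} _ (+≤+ () , _)
within-2 {+ suc (suc (suc _))} (_ , +≤+ (s≤s (s≤s ())))
within-2 {y = + suc (suc (suc _))} _ (_ , +≤+ (s≤s (s≤s ())))

centred-3 : ∀ {y} → 1ℤ ℤ.≤ y × y ℤ.≤ + 3 → ¬ ±2 (+ 2 ℤ.- y)
centred-3 {+ 1} _ = Sum.[ (λ ()) , (λ ()) ]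
centred-3 {+ 2} _ = Sum.[ (λ ()) , (λ ()) ]
centred-3 {+ 3} _ = Sum.[ (λ ()) , (λ ()) ]
centred-3 {+ 0} (+≤+ () , _)
centred-3 {+ suc (suc (suc (suc _)))} (_ , +≤+ (s≤s (s≤s (s≤s ()))))

p+q≡0⇒p≡q : ∀ p q → p ℙ.+ q ≡ 0ℙ → p ≡ q
p+q≡0⇒p≡q 0ℙ q  eq = ≡.sym eq
p+q≡0⇒p≡q 1ℙ 1ℙ eq = refl

-- A change by 2 does not fit into a side of length at most 2, so it always occurs in coordinate
-- `L`, whose parity is therefore constant along a tour. Two squares with `L`-coordinates 1 and 2
-- contradict this.
thinExcept⇒noTour : ∀ (n : Vec ℕ k) L → (∀ i → 1 ≤ lookup n i) → 2 ≤ lookup n L →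
                    (∀ l → l ≢ L → lookup n l ≤ 2) → ¬ ClosedKnightTour n
thinExcept⇒noTour {k} n L 1≤n 2≤nL thin tour = contradiction 1≡0 λ ()
  where
  open HamiltonianCycle tour

  f : Vec ℤ k → Parity
  f a = parityℤ (lookup a L)

  narrow : ∀ a l → l ≢ L → OnBoard n a → 1ℤ ℤ.≤ lookup a l × lookup a l ℤ.≤ + 2
  narrow a l l≢L on = proj₁ (on l) , ℤ.≤-trans (proj₂ (on l)) (+≤+ (thin l l≢L))

  same : ∀ a b → Graph.Edge (knightGraph n) a b → f a ≡ f b
  same a b (onA , onB , i , j , _ , two , _) with j Fin.≟ L | subst ±2 (Vec.lookup-zipWith ℤ._-_ j a b) two
  ... | yes refl | two′ = p+q≡0⇒p≡q (f a) (f b)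
    (≡.trans (≡.sym (parity-- (lookup a L) (lookup b L))) (±2-even two′))
  ... | no j≢L  | two′ = contradiction two′ (within-2 (narrow a j j≢L onA) (narrow b j j≢L onB))

  corner neighbour : Vec ℤ k
  corner    = Vec.replicate k 1ℤ
  neighbour = corner Vec.[ L ]≔ + 2

  f-constant : ∀ a → OnBoard n a → f a ≡ f start
  f-constant a on = constant f same closed (∈-++⁺ˡ (Equivalence.to (spanning a) on))

  onCorner : OnBoard n corner
  onCorner i rewrite Vec.lookup-replicate i 1ℤ = ℤ.≤-refl , +≤+ (1≤n i)

  onNeighbour : OnBoard n neighbour
  onNeighbour i with i Fin.≟ L
  ... | yes refl rewrite Vec.lookup∘updateAt L {λ _ → + 2} corner = +≤+ (s≤s z≤n) , +≤+ 2≤nL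
  ... | no  i≢L  rewrite Vec.lookup∘updateAt′ i L {λ _ → + 2} i≢L corner = onCorner i

  1≡0 : 1ℙ ≡ 0ℙ
  1≡0 = begin
    1ℙ           ≡⟨ cong parityℤ (Vec.lookup-replicate L 1ℤ) ⟨
    f corner     ≡⟨ f-constant corner onCorner ⟩
    f start      ≡⟨ f-constant neighbour onNeighbour ⟨
    f neighbour  ≡⟨ cong parityℤ (Vec.lookup∘updateAt L {λ _ → + 2} corner) ⟩
    0ℙ           ∎
    where open ≡-Reasoning

-- The appended `u` provides a successor for the last element as well.
successor : ∀ {A : Set} {R : A → A → Set} ws {u a} → Linked R (ws ∷ʳ u) → a ∈ ws → ∃ λ b → R a b
successor (_ ∷ [])     (r ∷ [-]) (here refl) = _ , r
successor (_ ∷ _ ∷ _)  (r ∷ l)   (here refl) = _ , r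
successor (_ ∷ _ ∷ ws) (r ∷ l)   (there a∈)  = successor (_ ∷ ws) l a∈

thin⇒noTour : ∀ (n : Vec ℕ k) → (∀ i → 2 ≤ lookup n i × lookup n i ≤ 3) → ¬ ClosedKnightTour n
thin⇒noTour {k} n thin tour = stuck (successor (start ∷ rest) closed (Equivalence.to (spanning centre) onCentre))
  where
  open HamiltonianCycle tour

  centre : Vec ℤ k
  -- The coordinate is 1 on a side of length 2 and 2 on a side of length 3; neither can change by 2
  -- within the board.
  centre = tabulate (λ i → + ℕ.pred (lookup n i))

  onCentre : OnBoard n centre
  onCentre i rewrite Vec.lookup∘tabulate (λ i → + ℕ.pred (lookup n i)) i =
    +≤+ (ℕ.pred-mono-≤ (proj₁ (thin i))) , +≤+ (ℕ.pred[n]≤n)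

  isolated : ∀ m y → 2 ≤ m × m ≤ 3 → 1ℤ ℤ.≤ y × y ℤ.≤ + m → ¬ ±2 (+ ℕ.pred m ℤ.- y)
  isolated 2 y _ on = within-2 (+≤+ (s≤s z≤n) , +≤+ (s≤s z≤n)) on
  isolated 3 y _ on = centred-3 on
  isolated 0 _ (() , _)
  isolated 1 _ (s≤s () , _)
  isolated (suc (suc (suc (suc _)))) _ (_ , s≤s (s≤s (s≤s ())))

  stuck : ¬ ∃ λ b → Graph.Edge (knightGraph n) centre b
  stuck (b , _ , on , _ , j , _ , two , _) = isolated (lookup n j) (lookup b j) (thin j) (on j)
    (subst ±2 (≡.trans (Vec.lookup-zipWith ℤ._-_ j centre b)
                       (cong (ℤ._- lookup b j) (Vec.lookup∘tabulate _ j))) two)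

-- The characterization

≢fromℕ⇒≤penultimate : ∀ k (l : Fin (2 + k)) → l ≢ fromℕ (1 + k) → l Fin.≤ inject₁ (fromℕ k)
≢fromℕ⇒≤penultimate k l l≢ = subst (toℕ l ≤_) (≡.sym (≡.trans (Fin.toℕ-inject₁ (fromℕ k)) (Fin.toℕ-fromℕ k)))
  (ℕ.≤-pred (ℕ.≤∧≢⇒< (ℕ.≤-pred (Fin.toℕ<n l)) λ eq →
    l≢ (Fin.toℕ-injective (≡.trans eq (≡.sym (Fin.toℕ-fromℕ (1 + k)))))))

theorem1p3 : ∀ (m : ℕ) (n : Vec ℕ (3 + m)) →
    2 ≤ lookup n zero →
    lookup n Preserves Fin._≤_ ⟶ _≤_ →
    (¬ ClosedKnightTour n) ⇔
    ( (∀ i → 2 ∤ lookup n i)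
    ⊎ lookup n (inject₁ (fromℕ (1 + m))) ≡ 2
    ⊎ lookup n (fromℕ (2 + m)) ≡ 3 )
theorem1p3 m n 2≤n₀ mono = mk⇔ noTour⇒ Sum.[ allOdd⇒noTour n , Sum.[ thin⇒ , flat⇒ ]′ ]′
  where
  penultimate last : Fin (3 + m)
  penultimate = inject₁ (fromℕ (1 + m))
  last        = fromℕ (2 + m)

  2≤n : ∀ i → 2 ≤ lookup n i
  2≤n i = ℕ.≤-trans 2≤n₀ (mono {zero} {i} z≤n)

  thin⇒ : lookup n penultimate ≡ 2 → ¬ ClosedKnightTour n
  thin⇒ eq = thinExcept⇒noTour n last (ℕ.<⇒≤ ∘ 2≤n) (2≤n last)
    λ l l≢last → subst (lookup n l ≤_) eq (mono (≢fromℕ⇒≤penultimate (1 + m) l l≢last))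

  flat⇒ : lookup n last ≡ 3 → ¬ ClosedKnightTour n
  flat⇒ eq = thin⇒noTour n λ i → 2≤n i , subst (lookup n i ≤_) eq (mono (Fin.≤fromℕ i))

  noTour⇒ : ¬ ClosedKnightTour n → _
  -- The three alternatives are tested in turn; if all fail, the hypotheses of `construct` hold.
  noTour⇒ noTour with Fin.any? (λ i → 2 ∣? lookup n i)
  ... | no noEven = inj₁ λ i even → noEven (i , even)
  ... | yes (i , even) with ℕ.m≤n⇒m<n∨m≡n (2≤n penultimate)
  ...   | inj₂ 2≡ = inj₂ (inj₁ (≡.sym 2≡))
  -- By monotonicity the last side is at least 3 too, so it equals 3 or is at least 4.
  ...   | inj₁ 3≤ with ℕ.m≤n⇒m<n∨m≡n (ℕ.≤-trans 3≤ (mono (Fin.≤fromℕ penultimate)))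
  ...     | inj₂ 3≡ = inj₂ (inj₂ (≡.sym 3≡))
  ...     | inj₁ 4≤ = contradiction (closedKnightTour (construct m n i even 2≤n mono 3≤ 4≤)) noTour
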